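{- For every forest $F$ with at least one vertex, every graph $G$ and every $S\subseteq V(G)$: if $G$ has no $S$-rooted model of $F$, then $\operatorname{pw}(G,S)\leq 2|V(F)|-2$.
   Context: A model of $H$ in $G$ is a family $(B_x\mid x\in V(H))$ of pairwise disjoint subsets of $V(G)$ such that each $G[B_x]$ is non-empty and connected and for every edge $xy\in E(H)$ there is an edge of $G$ between $B_x$ and $B_y$; it is $S$-rooted if $B_x\cap S\neq\emptyset$ for all $x$. A path decomposition of a graph $H$ is a sequence of bags $(W_1,\dots,W_m)$, $m\ge1$, of subsets of $V(H)$ such that every edge of $H$ lies in some bag and for every vertex $v$ the set $\{i:v\in W_i\}$ is a non-empty interval; its width is $\max_i|W_i|-1$. A path decomposition of $(G,S)$ is a path decomposition $\mathcal B$ of some induced subgraph $H$ of $G$ with $S\subseteq V(H)$ such that for every component $C$ of $G-V(H)$ some bag of $\mathcal B$ contains all neighbours of $V(C)$ in $G$. $\operatorname{pw}(G,S)$ is the minimum width of a path decomposition of $(G,S)$. -}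

module Defs where

open import Data.Nat using (ℕ; zero; suc; _+_; _*_; _∸_; _≤_; _<_)
open import Data.Fin using (Fin; toℕ)
open import Data.Fin.Subset using (Subset; _∈_; _∉_; _⊆_; ∣_∣)
open import Data.Bool using (Bool; true; false)
open import Data.Product using (Σ; ∃; ∃-syntax; _×_; _,_)
open import Data.Empty using (⊥)
open import Relation.Nullary using (¬_)
open import Relation.Binary.PropositionalEquality using (_≡_)
open import Function.Definitions using (Injective)

record Graph : Set where
  field
    n      : ℕ
    adj    : Fin n → Fin n → Bool
    sym    : ∀ u v → adj u v ≡ adj v u
    irrefl : ∀ u → adj u u ≡ false

open Graph public

V : Graph → Set
V G = Fin (n G)

E : (G : Graph) → V G → V G → Set
E G u v = adj G u v ≡ true

record Cycle (G : Graph) : Set where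
  field
    k        : ℕ
    c        : Fin (suc (suc (suc k))) → V G
    distinct : Injective _≡_ _≡_ c
    consec   : ∀ i j → toℕ j ≡ suc (toℕ i) → E G (c i) (c j)
    closing  : ∀ i j → toℕ i ≡ suc (suc k) → toℕ j ≡ 0 → E G (c i) (c j)

Forest : Graph → Set
Forest G = ¬ Cycle G

data WalkIn (G : Graph) (A : Subset (n G)) : V G → V G → Set where
  here : ∀ {u} → u ∈ A → WalkIn G A u u
  step : ∀ {u w v} → u ∈ A → E G u w → WalkIn G A w v → WalkIn G A u v

-- G[A] is connected (as a graph; nonemptiness is stated separately).
ConnectedIn : (G : Graph) → Subset (n G) → Set
ConnectedIn G A = ∀ u v → u ∈ A → v ∈ A → WalkIn G A u v

Disjoint : ∀ {m} → Subset m → Subset m → Set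
Disjoint A B = ∀ v → v ∈ A → v ∈ B → ⊥

record RootedModel (H G : Graph) (S : Subset (n G)) : Set where
  field
    B         : V H → Subset (n G)
    disjoint  : ∀ x y → ¬ (x ≡ y) → Disjoint (B x) (B y)
    nonempty  : ∀ x → ∃[ v ] v ∈ B x
    connected : ∀ x → ConnectedIn G (B x)
    edges     : ∀ x y → E H x y → ∃[ u ] ∃[ v ] (u ∈ B x × v ∈ B y × E G u v)
    rooted    : ∀ x → ∃[ v ] (v ∈ B x × v ∈ S)

IsComponentOutside : (G : Graph) → Subset (n G) → Subset (n G) → Set
IsComponentOutside G X C =
  (∀ v → v ∈ C → v ∉ X) ×
  (∃[ v ] v ∈ C) ×
  ConnectedIn G C ×
  (∀ u w → u ∈ C → w ∉ X → E G u w → w ∈ C)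

-- A path decomposition of (G,S): H = G[X] with S ⊆ X, bags W₀,…,W_m (m+1 ≥ 1 bags).
record PathDecomposition (G : Graph) (S : Subset (n G)) : Set where
  field
    X        : Subset (n G)
    S⊆X      : S ⊆ X
    m        : ℕ
    W        : Fin (suc m) → Subset (n G)
    W⊆X      : ∀ i → W i ⊆ X
    edgeCov  : ∀ u v → u ∈ X → v ∈ X → E G u v → ∃[ i ] (u ∈ W i × v ∈ W i)
    vtxCov   : ∀ v → v ∈ X → ∃[ i ] v ∈ W i
    interval : ∀ v i j k → toℕ i ≤ toℕ j → toℕ j ≤ toℕ k → v ∈ W i → v ∈ W k → v ∈ W j
    compCov  : ∀ C → IsComponentOutside G X C →
               ∃[ i ] (∀ w → w ∉ C → (∃[ c ] (c ∈ C × E G c w)) → w ∈ W i)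

  -- width = max |W_i| - 1, expressed as: every bag has size ≤ width + 1
HasWidth≤ : ∀ {G S} → PathDecomposition G S → ℕ → Set
HasWidth≤ D w = ∀ i → ∣ PathDecomposition.W D i ∣ ≤ suc w

pw≤ : (G : Graph) → Subset (n G) → ℕ → Set
pw≤ G S w = Σ (PathDecomposition G S) λ D → HasWidth≤ D w

{-# OPTIONS --safe #-}
module Submission where

-- Call X good if ∅ can be grown to X through an increasing chain in which consecutive sets X ⊆ Y
-- satisfy |∂X ∪ ∂Y ∪ (S ∩ (Y ∖ X))| ≤ 2|V(F)| − 1, where ∂X is the set of vertices of X with a
-- neighbour outside X.  These unions are the bags of a path decomposition of (G,S) as soon as V(G)
-- is good.  Otherwise, following Diestel's short proof of the path-width theorem, a model of F is
-- built by adding the vertices of F one at a time, each a leaf or isolated when it comes, inside a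
-- good set X which is maximal subject to |∂X| ≤ i and each of whose boundary vertices lies in one
-- of the i branch sets.  Uncrossing shows that good sets are closed under passing to subsets with
-- minimal boundary, so by Menger the branch sets can be extended to the boundary of the next
-- maximal set.  Finally Menger links ∂X to S: a separator T with |T| < |V(F)| would give a good
-- Z ⊇ X with ∂Z ⊆ T, by means of the bag ∂X ∪ T of size at most 2|V(F)| − 1.

open import Defs
open import Data.Bool using (true; false)
import Data.Bool.Properties as Bool
open import Data.Fin using (Fin; toℕ; fromℕ<)
import Data.Fin.Properties as Fin
open import Data.Fin.Subset
open import Data.Fin.Subset.Properties
open import Data.Nat using (ℕ; zero; suc; _+_; _*_; _∸_; _≤_; _<_; _≥_; z≤n; s≤s; s≤s⁻¹; _≤?_; _<?_)
open import Data.Nat.Properties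
open import Data.Product using (∃; ∃-syntax; _×_; _,_; proj₁; proj₂)
open import Data.Sum using (_⊎_; inj₁; inj₂; [_,_]′)
open import Data.Vec using ([]; _∷_; tabulate; here; there)
import Data.Vec.Properties as Vec
open import Function using (_∘_)
open import Relation.Nullary using (¬_; Dec; yes; no; does; contradiction; ¬?; _×-dec_; _⊎-dec_)
open import Relation.Nullary.Decidable using (decidable-stable; dec-true)
import Relation.Nullary.Decidable as Dec
open import Relation.Unary using (Decidable)
open import Relation.Binary.PropositionalEquality using (_≡_; _≢_; refl; trans; cong; subst) renaming (sym to ≡-sym)

-- Subsets of finite sets: comprehension, cardinality and extremal subsets.

module _ {m : ℕ} {P : Fin m → Set} (P? : Decidable P) where

  ⟦_⟧ : Subset m
  ⟦_⟧ = tabulate (does ∘ P?)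

  ∈⟦⟧⁺ : ∀ {v} → P v → v ∈ ⟦_⟧
  ∈⟦⟧⁺ {v} p = Vec.lookup⇒[]= v _ (trans (Vec.lookup∘tabulate (does ∘ P?) v) (dec-true (P? v) p))

  ∈⟦⟧⁻ : ∀ {v} → v ∈ ⟦_⟧ → P v
  ∈⟦⟧⁻ {v} v∈ with P? v | trans (≡-sym (Vec.lookup∘tabulate (does ∘ P?) v)) (Vec.[]=⇒lookup v∈)
  ... | yes p | _ = p
  ... | no _  | ()

∈-∪⁻ : ∀ {m} {p q : Subset m} {v} → v ∈ p ∪ q → v ∈ p ⊎ v ∈ q
∈-∪⁻ {p = p} {q} = x∈p∪q⁻ p q

∈-∩⁻ : ∀ {m} {p q : Subset m} {v} → v ∈ p ∩ q → v ∈ p × v ∈ q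
∈-∩⁻ {p = p} {q} = x∈p∩q⁻ p q

∪ˡ : ∀ {m} {p q : Subset m} → p ⊆ p ∪ q
∪ˡ {q = q} = p⊆p∪q q

∪ʳ : ∀ {m} {p q : Subset m} → q ⊆ p ∪ q
∪ʳ {p = p} {q} = q⊆p∪q p q

∪-lub : ∀ {m} {p q r : Subset m} → p ⊆ r → q ⊆ r → p ∪ q ⊆ r
∪-lub p⊆r q⊆r v∈ with ∈-∪⁻ v∈
... | inj₁ v∈p = p⊆r v∈p
... | inj₂ v∈q = q⊆r v∈q

⁅⁆⊆ : ∀ {m} {x : Fin m} {p : Subset m} → x ∈ p → ⁅ x ⁆ ⊆ p
⁅⁆⊆ {x = x} {p} x∈p y∈ = subst (_∈ p) (≡-sym (x∈⁅y⁆⇒x≡y x y∈)) x∈p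

∈-─⁻ : ∀ {m} {p q : Subset m} {v} → v ∈ p ─ q → v ∈ p × v ∉ q
∈-─⁻ {p = p} {q} v∈ = p─q⊆p p q v∈ , v∉q v∈
  where
  v∉q : ∀ {m} {p q : Subset m} {v} → v ∈ p ─ q → v ∉ q
  v∉q {p = _ ∷ p}    {_ ∷ q} (there v∈) (there v∈q) = v∉q {p = p} {q} v∈ v∈q
  v∉q {p = true ∷ _}  () here
  v∉q {p = false ∷ _} () here

⊆∧∣∣≤⇒⊇ : ∀ {m} {p q : Subset m} → p ⊆ q → ∣ q ∣ ≤ ∣ p ∣ → q ⊆ p
⊆∧∣∣≤⇒⊇ {p = p} p⊆q ∣q∣≤∣p∣ {x} x∈q =
  decidable-stable (x ∈? p) λ x∉p → <⇒≱ (p⊂q⇒∣p∣<∣q∣ (p⊆q , x , x∈q , x∉p)) ∣q∣≤∣p∣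

∣∪∣+∣∩∣ : ∀ {m} (p q : Subset m) → ∣ p ∪ q ∣ + ∣ p ∩ q ∣ ≡ ∣ p ∣ + ∣ q ∣
∣∪∣+∣∩∣ []          []          = refl
∣∪∣+∣∩∣ (true  ∷ p) (true  ∷ q) = cong suc (trans (+-suc _ _) (trans (cong suc (∣∪∣+∣∩∣ p q)) (≡-sym (+-suc _ _))))
∣∪∣+∣∩∣ (true  ∷ p) (false ∷ q) = cong suc (∣∪∣+∣∩∣ p q)
∣∪∣+∣∩∣ (false ∷ p) (true  ∷ q) = trans (cong suc (∣∪∣+∣∩∣ p q)) (≡-sym (+-suc _ _))
∣∪∣+∣∩∣ (false ∷ p) (false ∷ q) = ∣∪∣+∣∩∣ p q

-- The common core of the submodularity estimates for bags and boundaries.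
∣∣-uncross : ∀ {m} {p q r s : Subset m} →
  (∀ {v} → v ∈ p → v ∈ r ⊎ v ∈ s) → (∀ {v} → v ∈ q → v ∈ r ⊎ v ∈ s) →
  (∀ {v} → v ∈ p → v ∈ q → v ∈ r × v ∈ s) →
  ∣ p ∣ + ∣ q ∣ ≤ ∣ r ∣ + ∣ s ∣
∣∣-uncross {p = p} {q} {r} {s} p⊆ q⊆ p∩q⊆ = begin
  ∣ p ∣ + ∣ q ∣          ≡⟨ ∣∪∣+∣∩∣ p q ⟨
  ∣ p ∪ q ∣ + ∣ p ∩ q ∣  ≤⟨ +-mono-≤ (p⊆q⇒∣p∣≤∣q∣ ∪⊆∪) (p⊆q⇒∣p∣≤∣q∣ ∩⊆∩) ⟩
  ∣ r ∪ s ∣ + ∣ r ∩ s ∣  ≡⟨ ∣∪∣+∣∩∣ r s ⟩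
  ∣ r ∣ + ∣ s ∣          ∎
  where
  open ≤-Reasoning
  ∪⊆∪ : p ∪ q ⊆ r ∪ s
  ∪⊆∪ v∈ with ∈-∪⁻ v∈
  ... | inj₁ v∈p = x∈p∪q⁺ (p⊆ v∈p)
  ... | inj₂ v∈q = x∈p∪q⁺ (q⊆ v∈q)
  ∩⊆∩ : p ∩ q ⊆ r ∩ s
  ∩⊆∩ v∈ with v∈p , v∈q ← ∈-∩⁻ v∈ = x∈p∩q⁺ (p∩q⊆ v∈p v∈q)

∣∪∣≤ : ∀ {m} (p q : Subset m) → ∣ p ∪ q ∣ ≤ ∣ p ∣ + ∣ q ∣
∣∪∣≤ p q = ≤-trans (m≤m+n _ _) (≤-reflexive (∣∪∣+∣∩∣ p q))

∣∪⁅⁆∣≤ : ∀ {m} (p : Subset m) x → ∣ p ∪ ⁅ x ⁆ ∣ ≤ suc ∣ p ∣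
∣∪⁅⁆∣≤ p x = ≤-trans (∣∪∣≤ p ⁅ x ⁆) (≤-reflexive (trans (cong (∣ p ∣ +_) (∣⁅x⁆∣≡1 x)) (+-comm ∣ p ∣ 1)))

∣-∣≡ : ∀ {m} {p : Subset m} {x} → x ∈ p → suc ∣ p - x ∣ ≡ ∣ p ∣
∣-∣≡ {p = p} {x} x∈p = ≤-antisym (x∈p⇒∣p-x∣<∣p∣ x∈p)
  (≤-trans (p⊆q⇒∣p∣≤∣q∣ p⊆) (∣∪⁅⁆∣≤ (p - x) x))
  where
  p⊆ : p ⊆ (p - x) ∪ ⁅ x ⁆
  p⊆ {v} v∈p with v Fin.≟ x
  ... | yes refl = ∪ʳ {p = p - x} (x∈⁅x⁆ x)
  ... | no v≢x   = ∪ˡ (x∈p∧x≢y⇒x∈p-y v∈p v≢x)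

-- Descent: as long as some subset with `P` has a smaller `f`, move to it; `d` bounds the number of
-- moves.
argmin : ∀ {m} {P : Subset m → Set} (P? : Decidable P) (f : Subset m → ℕ) →
  ∀ {X} → P X → ∃[ Y ] P Y × (∀ Z → P Z → f Y ≤ f Z)
argmin {P = P} P? f {X} pX = go (f X) pX ≤-refl
  where
  go : ∀ d {X} → P X → f X ≤ d → ∃[ Y ] P Y × (∀ Z → P Z → f Y ≤ f Z)
  go d {X} pX fX≤d with anySubset? (λ Z → P? Z ×-dec (f Z <? f X))
  ... | no ∄Z = X , pX , λ Z pZ → ≮⇒≥ λ fZ<fX → ∄Z (Z , pZ , fZ<fX)
  go zero    pX fX≤d | yes (Z , pZ , fZ<fX) = contradiction (≤-trans fZ<fX fX≤d) λ ()
  go (suc d) pX fX≤d | yes (Z , pZ , fZ<fX) = go d pZ (s≤s⁻¹ (≤-trans fZ<fX fX≤d))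

maximal⊇ : ∀ {m} {P : Subset m → Set} (P? : Decidable P) →
  ∀ {X} → P X → ∃[ Y ] X ⊆ Y × P Y × (∀ Z → Y ⊆ Z → P Z → Z ⊆ Y)
maximal⊇ P? {X} pX
  with Y , (X⊆Y , pY) , min ← argmin (λ Z → (X ⊆? Z) ×-dec P? Z) (λ Z → ∣ ∁ Z ∣) {X} (⊆-refl , pX) =
  Y , X⊆Y , pY , λ Z Y⊆Z pZ →
    ∁p⊆∁q⇒p⊇q (⊆∧∣∣≤⇒⊇ (p⊆q⇒∁p⊇∁q Y⊆Z) (min Z (⊆-trans X⊆Y Y⊆Z , pZ)))

-- Boundaries, good sets and path decompositions

module _ (G : Graph) where

  E-sym : ∀ {u v} → E G u v → E G v u
  E-sym {u} {v} = trans (sym G v u)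

  E? : ∀ u v → Dec (E G u v)
  E? u v = adj G u v Bool.≟ true

  Exits : Subset (n G) → V G → Set
  Exits Z v = ∃[ w ] w ∉ Z × E G v w

  exits? : ∀ Z → Decidable (Exits Z)
  exits? Z v = Fin.any? λ w → ¬? (w ∈? Z) ×-dec E? v w

  exits-anti : ∀ {Y Z v} → Y ⊆ Z → Exits Z v → Exits Y v
  exits-anti Y⊆Z (w , w∉Z , e) = w , w∉Z ∘ Y⊆Z , e

  ∂ : Subset (n G) → Subset (n G)
  ∂ Z = ⟦ (λ v → (v ∈? Z) ×-dec exits? Z v) ⟧

  ∂⁺ : ∀ {Z v} → v ∈ Z → Exits Z v → v ∈ ∂ Z
  ∂⁺ {Z} v∈Z ex = ∈⟦⟧⁺ (λ v → (v ∈? Z) ×-dec exits? Z v) (v∈Z , ex)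

  ∂⁻ : ∀ {Z v} → v ∈ ∂ Z → v ∈ Z × Exits Z v
  ∂⁻ {Z} = ∈⟦⟧⁻ (λ v → (v ∈? Z) ×-dec exits? Z v)

  ∂∪⁅⁆⊆ : ∀ X x → ∂ (X ∪ ⁅ x ⁆) ⊆ ∂ X ∪ ⁅ x ⁆
  ∂∪⁅⁆⊆ X x v∈∂ with v∈ , ex ← ∂⁻ v∈∂ with ∈-∪⁻ {p = X} v∈
  ... | inj₁ v∈X = ∪ˡ (∂⁺ v∈X (exits-anti ∪ˡ ex))
  ... | inj₂ v∈x = ∪ʳ {p = ∂ X} v∈x

  walk-start : ∀ {A u v} → WalkIn G A u v → u ∈ A
  walk-start (here u∈)     = u∈
  walk-start (step u∈ _ _) = u∈

module _ (G : Graph) (S : Subset (n G)) where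

  bag : Subset (n G) → Subset (n G) → Subset (n G)
  bag X Y = ∂ G X ∪ ∂ G Y ∪ (S ∩ (Y ─ X))

  data InBag (X Y : Subset (n G)) (v : V G) : Set where
    lower : v ∈ ∂ G X → InBag X Y v
    upper : v ∈ ∂ G Y → InBag X Y v
    root  : v ∈ S → v ∈ Y → v ∉ X → InBag X Y v

  bag⁻ : ∀ {X Y v} → v ∈ bag X Y → InBag X Y v
  bag⁻ {X} {Y} v∈ with ∈-∪⁻ {p = ∂ G X} v∈
  ... | inj₁ v∈∂X = lower v∈∂X
  ... | inj₂ v∈′ with ∈-∪⁻ {p = ∂ G Y} v∈′
  ...   | inj₁ v∈∂Y = upper v∈∂Y
  ...   | inj₂ v∈″ with v∈S , v∈Y─X ← ∈-∩⁻ {p = S} v∈″ with v∈Y , v∉X ← ∈-─⁻ {p = Y} v∈Y─X =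
    root v∈S v∈Y v∉X

  bag⁺ : ∀ {X Y v} → InBag X Y v → v ∈ bag X Y
  bag⁺ {X} {Y} (lower v∈∂X) = ∪ˡ v∈∂X
  bag⁺ {X} {Y} (upper v∈∂Y) = ∪ʳ {p = ∂ G X} (∪ˡ v∈∂Y)
  bag⁺ {X} {Y} (root v∈S v∈Y v∉X) =
    ∪ʳ {p = ∂ G X} (∪ʳ {p = ∂ G Y} (x∈p∩q⁺ (v∈S , x∈p∧x∉q⇒x∈p─q v∈Y v∉X)))

  inBag⊆ : ∀ {X Y v} → X ⊆ Y → InBag X Y v → v ∈ Y
  inBag⊆ X⊆Y (lower v∈∂X)    = X⊆Y (proj₁ (∂⁻ G v∈∂X))
  inBag⊆ X⊆Y (upper v∈∂Y)    = proj₁ (∂⁻ G v∈∂Y)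
  inBag⊆ X⊆Y (root _ v∈Y _) = v∈Y

  module _ (k : ℕ) where

    data Good : Subset (n G) → Set where
      start : Good ⊥
      grow  : ∀ {X Y} → Good X → X ⊆ Y → ∣ bag X Y ∣ ≤ k → Good Y

    -- A growth chain may repeat a set, so its last step need not shrink. `inverse` skips the
    -- repetitions, after which the search for a predecessor runs over proper subsets only and ends
    -- by size.
    good? : Decidable Good
    good? Y = go ∣ Y ∣ Y ≤-refl
      where
      Strict : Subset (n G) → Subset (n G) → Set
      Strict Y X = X ⊂ Y × Good X × ∣ bag X Y ∣ ≤ k

      inverse : ∀ {Y} → Good Y → Y ≡ ⊥ ⊎ ∃ (Strict Y)
      inverse start = inj₁ refl
      inverse {Y} (grow {X} gX X⊆Y b) with X ⊂? Y
      ... | yes X⊂Y = inj₂ (X , X⊂Y , gX , b)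
      ... | no X⊄Y  = subst (λ Z → Z ≡ ⊥ ⊎ ∃ (Strict Z)) (⊆-antisym X⊆Y Y⊆X) (inverse gX)
        where
        Y⊆X : Y ⊆ X
        Y⊆X {v} v∈Y = decidable-stable (v ∈? X) λ v∉X → X⊄Y (X⊆Y , v , v∈Y , v∉X)

      go : ∀ d Y → ∣ Y ∣ ≤ d → Dec (Good Y)
      strict? : ∀ d Y → ∣ Y ∣ ≤ d → Decidable (Strict Y)

      go d Y Y≤d with nonempty? Y | anySubset? (strict? d Y Y≤d)
      ... | _      | yes (X , (X⊆Y , _) , gX , b) = yes (grow gX X⊆Y b)
      ... | no  ∅Y | no _   = yes (subst Good (≡-sym (Empty-unique ∅Y)) start)
      ... | yes (v , v∈Y) | no ∄X = no ([ (λ { refl → ∉⊥ v∈Y }) , ∄X ]′ ∘ inverse)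

      strict? d Y Y≤d X with X ⊂? Y
      ... | no X⊄Y = no (X⊄Y ∘ proj₁)
      strict? zero    Y Y≤d X | yes X⊂Y = contradiction (≤-trans (p⊂q⇒∣p∣<∣q∣ X⊂Y) Y≤d) λ ()
      strict? (suc d) Y Y≤d X | yes X⊂Y =
        Dec.map′ (X⊂Y ,_) proj₂ (go d X (s≤s⁻¹ (≤-trans (p⊂q⇒∣p∣<∣q∣ X⊂Y) Y≤d)) ×-dec (∣ bag X Y ∣ ≤? k))

    -- Intersect the whole chain of `Y` with `Z`. Uncrossing trades the bag of an intersected step
    -- together with `∂ G (Y ∪ Z)` for the original bag together with `∂ G Z`; as `∂ G Z` is no
    -- larger than `∂ G (Y ∪ Z)`, bags do not grow. The minimality ranges up to `Y ∪ Z` because the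
    -- earlier sets of the chain need not contain `Z`.
    good-∩ : ∀ {Y Z} → Good Y → (∀ W → Z ⊆ W → W ⊆ Y ∪ Z → ∣ ∂ G Z ∣ ≤ ∣ ∂ G W ∣) → Good (Y ∩ Z)
    good-∩ {Z = Z} start min = subst Good (≡-sym (∩-zeroˡ Z)) start
    good-∩ {Z = Z} (grow {X} {Y} gX X⊆Y b) min =
      grow (good-∩ gX λ W Z⊆W W⊆ → min W Z⊆W (⊆-trans W⊆ (∪-lub (⊆-trans X⊆Y ∪ˡ) (∪ʳ {p = Y})))) ∩⊆∩
        (≤-trans (+-cancelʳ-≤ (∣ ∂ G (Y ∪ Z) ∣) _ _
          (≤-trans uncross (+-monoʳ-≤ (∣ bag X Y ∣) (min (Y ∪ Z) (∪ʳ {p = Y}) ⊆-refl)))) b)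
      where
      ∩⊆∩ : X ∩ Z ⊆ Y ∩ Z
      ∩⊆∩ v∈ with v∈X , v∈Z ← ∈-∩⁻ {p = X} v∈ = x∈p∩q⁺ (X⊆Y v∈X , v∈Z)

      exits-∩ : ∀ {U v} → v ∈ U → v ∈ Z → Exits G (U ∩ Z) v → v ∈ ∂ G U ⊎ v ∈ ∂ G Z
      exits-∩ {U} v∈U v∈Z (w , w∉ , e) with w ∈? U
      ... | yes w∈U = inj₂ (∂⁺ G v∈Z (w , (λ w∈Z → w∉ (x∈p∩q⁺ (w∈U , w∈Z))) , e))
      ... | no w∉U  = inj₁ (∂⁺ G v∈U (w , w∉U , e))

      bag⊆ : ∀ {v} → v ∈ bag (X ∩ Z) (Y ∩ Z) → v ∈ bag X Y ⊎ v ∈ ∂ G Z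
      bag⊆ v∈ with bag⁻ v∈
      ... | lower v∈∂ with v∈ , ex ← ∂⁻ G v∈∂ with v∈X , v∈Z ← ∈-∩⁻ {p = X} v∈ =
        [ inj₁ ∘ bag⁺ ∘ lower , inj₂ ]′ (exits-∩ v∈X v∈Z ex)
      ... | upper v∈∂ with v∈ , ex ← ∂⁻ G v∈∂ with v∈Y , v∈Z ← ∈-∩⁻ {p = Y} v∈ =
        [ inj₁ ∘ bag⁺ ∘ upper , inj₂ ]′ (exits-∩ v∈Y v∈Z ex)
      ... | root v∈S v∈ v∉ with v∈Y , v∈Z ← ∈-∩⁻ {p = Y} v∈ =
        inj₁ (bag⁺ (root v∈S v∈Y λ v∈X → v∉ (x∈p∩q⁺ (v∈X , v∈Z))))

      ∂∪⊆ : ∀ {v} → v ∈ ∂ G (Y ∪ Z) → v ∈ bag X Y ⊎ v ∈ ∂ G Z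
      ∂∪⊆ v∈∂ with v∈ , ex ← ∂⁻ G v∈∂ with ∈-∪⁻ {p = Y} v∈
      ... | inj₁ v∈Y = inj₁ (bag⁺ (upper (∂⁺ G v∈Y (exits-anti G ∪ˡ ex))))
      ... | inj₂ v∈Z = inj₂ (∂⁺ G v∈Z (exits-anti G (∪ʳ {p = Y}) ex))

      both : ∀ {v} → v ∈ bag (X ∩ Z) (Y ∩ Z) → v ∈ ∂ G (Y ∪ Z) → v ∈ bag X Y × v ∈ ∂ G Z
      both v∈W v∈∂ with v∈Y , v∈Z ← ∈-∩⁻ {p = Y} (inBag⊆ ∩⊆∩ (bag⁻ v∈W)) with _ , ex ← ∂⁻ G v∈∂ =
        bag⁺ (upper (∂⁺ G v∈Y (exits-anti G ∪ˡ ex))) , ∂⁺ G v∈Z (exits-anti G (∪ʳ {p = Y}) ex)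

      uncross : ∣ bag (X ∩ Z) (Y ∩ Z) ∣ + ∣ ∂ G (Y ∪ Z) ∣ ≤ ∣ bag X Y ∣ + ∣ ∂ G Z ∣
      uncross = ∣∣-uncross bag⊆ ∂∪⊆ both

    good-minimal : ∀ {Y Z} → Good Y → Z ⊆ Y → (∀ W → Z ⊆ W → W ⊆ Y → ∣ ∂ G Z ∣ ≤ ∣ ∂ G W ∣) → Good Z
    good-minimal {Y} {Z} gY Z⊆Y min =
      subst Good (⊆-antisym (p∩q⊆q Y Z) λ v∈Z → x∈p∩q⁺ (Z⊆Y v∈Z , v∈Z))
        (good-∩ gY λ W Z⊆W W⊆ → min W Z⊆W (⊆-trans W⊆ (∪-lub ⊆-refl Z⊆Y)))

    -- The growth chain read backwards: level 0 is Y, and ∅ is reached at the depth.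
    level : ∀ {Y} → Good Y → ℕ → Subset (n G)
    level {Y} _                zero    = Y
    level     start            (suc i) = ⊥
    level     (grow gX _ _)    (suc i) = level gX i

    depth : ∀ {Y} → Good Y → ℕ
    depth start         = zero
    depth (grow gX _ _) = suc (depth gX)

    level-depth : ∀ {Y} (g : Good Y) → level g (depth g) ≡ ⊥
    level-depth start         = refl
    level-depth (grow gX _ _) = level-depth gX

    level-anti : ∀ {Y} (g : Good Y) i → level g (suc i) ⊆ level g i
    level-anti start           zero    = ⊆-refl
    level-anti start           (suc i) = ⊆-refl
    level-anti (grow gX X⊆Y _) zero    = X⊆Y
    level-anti (grow gX _ _)   (suc i) = level-anti gX i

    -- Used for the steps past the depth; the last bag of the decomposition is one of them.
    bag-⊥ : ∣ bag ⊥ ⊥ ∣ ≤ k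
    bag-⊥ = ≤-trans (p⊆q⇒∣p∣≤∣q∣ {q = ⊥} (inBag⊆ ⊆-refl ∘ bag⁻)) (≤-trans (≤-reflexive (∣⊥∣≡0 (n G))) z≤n)

    level-bag : ∀ {Y} (g : Good Y) i → ∣ bag (level g (suc i)) (level g i) ∣ ≤ k
    level-bag start         zero    = bag-⊥
    level-bag start         (suc i) = bag-⊥
    level-bag (grow gX _ b) zero    = b
    level-bag (grow gX _ _) (suc i) = level-bag gX i

  -- Path decomposition from a decreasing chain.

  module Decomposition (D : ℕ → Subset (n G)) (d : ℕ)
    (D-anti : ∀ i → D (suc i) ⊆ D i) (D-top : ∀ {v} → v ∈ D 0) (D-bot : ∀ {v} → v ∉ D d) where

    W : ℕ → Subset (n G)
    W i = bag (D (suc i)) (D i)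

    D-anti* : ∀ {i j} → i ≤ j → D j ⊆ D i
    D-anti* {zero}  {zero}  _   = ⊆-refl
    D-anti* {i}     {suc j} i≤j with m≤n⇒m<n∨m≡n i≤j
    ... | inj₁ i<1+j = ⊆-trans (D-anti j) (D-anti* (s≤s⁻¹ i<1+j))
    ... | inj₂ refl  = ⊆-refl

    -- The growth step in which `v` enters. As `D` decreases, `i` is unique, and no bag of larger
    -- index contains `v`.
    At : V G → ℕ → Set
    At v i = v ∈ D i × v ∉ D (suc i)

    at : ∀ v → ∃[ i ] i ≤ d × At v i
    at v = go d D-bot
      where
      go : ∀ j → v ∉ D j → ∃[ i ] i ≤ j × At v i
      go zero    v∉ = contradiction D-top v∉
      go (suc j) v∉ with v ∈? D j
      ... | yes v∈ = j , n≤1+n j , v∈ , v∉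
      ... | no v∉′ with i , i≤j , a ← go j v∉′ = i , m≤n⇒m≤1+n i≤j , a

    at-max : ∀ {v i j} → At v i → v ∈ D j → j ≤ i
    at-max {i = i} {j} (_ , v∉) v∈ = ≮⇒≥ λ i<j → v∉ (D-anti* i<j v∈)

    W⊆D : ∀ i → W i ⊆ D i
    W⊆D i = inBag⊆ (D-anti i) ∘ bag⁻

    -- An exit from a set is an exit from each smaller one, and `D i` is the smallest level that
    -- contains `v`.
    ∂-at : ∀ {v i j} → At v i → v ∈ ∂ G (D j) → v ∈ W i
    ∂-at a v∈∂ with v∈ , ex ← ∂⁻ G v∈∂ =
      bag⁺ (upper (∂⁺ G (proj₁ a) (exits-anti G (D-anti* (at-max a v∈)) ex)))

    W-at : ∀ {v i j} → At v i → v ∈ W j → v ∈ W i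
    W-at a v∈ with bag⁻ v∈
    ... | lower v∈∂      = ∂-at a v∈∂
    ... | upper v∈∂      = ∂-at a v∈∂
    ... | root v∈S _ _ = bag⁺ (root v∈S (proj₁ a) (proj₂ a))

    -- A boundary vertex of a level stays on the boundary of each smaller level that still contains
    -- it. A vertex that is in `W i` as an entering root lies in no level of larger index.
    W-interval : ∀ {v i j k} → i ≤ j → j ≤ k → v ∈ W i → v ∈ W k → v ∈ W j
    W-interval {v} {i} {j} {k} i≤j j≤k v∈Wi v∈Wk with m≤n⇒m<n∨m≡n i≤j
    ... | inj₂ refl = v∈Wi
    ... | inj₁ i<j with bag⁻ v∈Wi
    ...   | lower v∈∂ = bag⁺ (upper (∂⁺ G (D-anti* j≤k (W⊆D k v∈Wk)) (exits-anti G (D-anti* i<j) (proj₂ (∂⁻ G v∈∂)))))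
    ...   | upper v∈∂ = bag⁺ (upper (∂⁺ G (D-anti* j≤k (W⊆D k v∈Wk)) (exits-anti G (D-anti* i≤j) (proj₂ (∂⁻ G v∈∂)))))
    ...   | root _ _ v∉ = contradiction (D-anti* i<j (D-anti* j≤k (W⊆D k v∈Wk))) v∉

    -- If `i < j`, then `u` is outside `D (suc i)` while `v` is already inside, so `v` is in the
    -- lower boundary of the bag. If `i` equals `j`, it suffices that `v` is in some bag.
    W-nbr : ∀ {u v i j} → At u i → At v j → i ≤ j → E G u v → ∀ {l} → v ∈ W l → v ∈ W i
    W-nbr {u} {v} {i} {j} au av i≤j e v∈Wl with m≤n⇒m<n∨m≡n i≤j
    ... | inj₂ refl = W-at av v∈Wl
    ... | inj₁ i<j  = bag⁺ (lower (∂⁺ G (D-anti* i<j (proj₁ av)) (u , proj₂ au , E-sym G e)))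

    Covered : V G → Set
    Covered v = ∃[ i ] v ∈ W (toℕ {suc d} i)

    covered? : Decidable Covered
    covered? v = Fin.any? λ i → v ∈? W (toℕ i)

    index : ∀ (P : ℕ → Set) {i} → i ≤ d → P i → ∃[ j ] P (toℕ {suc d} j)
    index P i≤d p = fromℕ< (s≤s i≤d) , subst P (≡-sym (Fin.toℕ-fromℕ< (s≤s i≤d))) p

    ∂-covered : ∀ {v j} → v ∈ ∂ G (D j) → Covered v
    ∂-covered {v} v∈∂ with i , i≤d , a ← at v = index (λ i → v ∈ W i) i≤d (∂-at a v∈∂)

    -- Were `j < i`, the edge would leave `D (suc j)` at `u` and put `u` into a bag.
    uncovered-nbr : ∀ {u v i j} → At u i → At v j → ¬ Covered u → E G u v → i ≤ j
    uncovered-nbr {v = v} au av ¬u e = ≮⇒≥ λ j<i →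
      ¬u (∂-covered (∂⁺ G (D-anti* j<i (proj₁ au)) (v , proj₂ av , e)))

    edge-covered : ∀ {u v} → Covered u → Covered v → E G u v →
      ∃[ i ] u ∈ W (toℕ {suc d} i) × v ∈ W (toℕ i)
    edge-covered {u} {v} (_ , u∈) (_ , v∈) e with at u | at v
    ... | i , i≤d , au | j , j≤d , av with ≤-total i j
    ...   | inj₁ i≤j = index (λ l → u ∈ W l × v ∈ W l) i≤d (W-at au u∈ , W-nbr au av i≤j e v∈)
    ...   | inj₂ j≤i = index (λ l → u ∈ W l × v ∈ W l) j≤d (W-nbr av au j≤i (E-sym G e) u∈ , W-at av v∈)

    -- Adjacent uncovered vertices enter at the same step, by comparing both ways. So a whole
    -- component outside the bags enters at a single step, and the bag of that step contains all its
    -- neighbours.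
    uncovered-walk : ∀ {C u v i} → (∀ c → c ∈ C → ¬ Covered c) → WalkIn G C u v → At u i → At v i
    uncovered-walk ¬C (here _) au = au
    uncovered-walk ¬C (step {w = w} u∈C e p) au with j , _ , aw ← at w =
      uncovered-walk ¬C p (subst (At w) (≤-antisym
        (uncovered-nbr aw au (¬C w (walk-start G p)) (E-sym G e))
        (uncovered-nbr au aw (¬C _ u∈C) e)) aw)

    decomposition : PathDecomposition G S
    decomposition = record
      { X        = X
      ; S⊆X      = λ {v} v∈S → let i , i≤d , v∈ , v∉ = at v in
                     ∈⟦⟧⁺ covered? (index (λ i → v ∈ W i) i≤d (bag⁺ (root v∈S v∈ v∉)))
      ; m        = d
      ; W        = λ i → W (toℕ i)
      ; W⊆X      = λ i v∈ → ∈⟦⟧⁺ covered? (i , v∈)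
      ; edgeCov  = λ u v u∈ v∈ → edge-covered (∈⟦⟧⁻ covered? u∈) (∈⟦⟧⁻ covered? v∈)
      ; vtxCov   = λ v → ∈⟦⟧⁻ covered?
      ; interval = λ v i j k → W-interval
      ; compCov  = compCov
      }
      where
      X : Subset (n G)
      X = ⟦ covered? ⟧

      compCov : ∀ C → IsComponentOutside G X C →
        ∃[ i ] (∀ w → w ∉ C → (∃[ c ] (c ∈ C × E G c w)) → w ∈ W (toℕ {suc d} i))
      compCov C (C∩X , (c₀ , c₀∈C) , connected , closed) with i , i≤d , a₀ ← at c₀ =
        index (λ i → ∀ w → w ∉ C → (∃[ c ] (c ∈ C × E G c w)) → w ∈ W i) i≤d nbrs
        where
        ¬C : ∀ c → c ∈ C → ¬ Covered c
        ¬C c c∈C = C∩X c c∈C ∘ ∈⟦⟧⁺ covered?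
        nbrs : ∀ w → w ∉ C → (∃[ c ] (c ∈ C × E G c w)) → w ∈ W i
        nbrs w w∉C (c , c∈C , e)
          with _ , w∈ ← ∈⟦⟧⁻ covered? (decidable-stable (w ∈? X) λ w∉X → w∉C (closed c w c∈C w∉X e))
          with j , _ , aw ← at w | ac ← uncovered-walk ¬C (connected c₀ c c₀∈C c∈C) a₀ =
          W-nbr ac aw (uncovered-nbr ac aw (¬C c c∈C) e) e w∈

  good⇒pw≤ : ∀ {w} → Good (suc w) ⊤ → pw≤ G S w
  good⇒pw≤ {w} g = decomposition , λ i → level-bag (suc w) g (toℕ i)
    where
    open Decomposition (level (suc w) g) (depth (suc w) g) (level-anti (suc w) g)
      ∈⊤ (λ v∈ → ∉⊥ (subst (_ ∈_) (level-depth (suc w) g) v∈))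

-- Leaves of forests

gap : ∀ {i j} → i < j → ∃[ l ] j ≡ suc l + i
gap {i} {j} i<j = j ∸ suc i , ≡-sym (trans (≡-sym (+-suc _ i)) (m∸n+n≡m i<j))

-- Degree at most one into `A`, so isolated vertices count.
LeafIn : (F : Graph) → Subset (n F) → V F → Set
LeafIn F A a = ∀ b c → b ∈ A → c ∈ A → E F a b → E F a c → b ≡ c

module _ {F : Graph} (forest : Forest F) where

  -- Without a leaf, each vertex of `A` has two neighbours in `A`, so a walk never has to turn back;
  -- its first repeated vertex closes a cycle.
  forest-leaf : ∀ A → Nonempty A → ∃[ a ] a ∈ A × LeafIn F A a
  forest-leaf A (a₀ , a₀∈A) with Fin.any? (λ a → (a ∈? A) ×-dec ¬? (branches? a))
    where
    branches? : ∀ a → Dec (∃[ b ] ∃[ c ] b ∈ A × c ∈ A × E F a b × E F a c × b ≢ c)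
    branches? a = Fin.any? λ b → Fin.any? λ c →
      (b ∈? A) ×-dec (c ∈? A) ×-dec E? F a b ×-dec E? F a c ×-dec ¬? (b Fin.≟ c)
  ... | yes (a , a∈A , ¬branches) = a , a∈A , λ b c b∈ c∈ ab ac →
    decidable-stable (b Fin.≟ c) λ b≢c → ¬branches (b , c , b∈ , c∈ , ab , ac , b≢c)
  ... | no ∄leaf = contradiction (search (suc (n F)) 0 (+-identityʳ _) (λ ())) forest
    where
    -- If `p` were the only possible neighbour, `a` would not branch. The walk starts with `p` equal
    -- to `a`, where the last condition only says that there are no loops.
    next : ∀ p a → a ∈ A → ∃[ b ] b ∈ A × E F a b × b ≢ p
    next p a a∈A with Fin.any? (λ b → (b ∈? A) ×-dec E? F a b ×-dec ¬? (b Fin.≟ p))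
    ... | yes found = found
    ... | no ∄b = contradiction (a , a∈A , λ (b , c , b∈ , c∈ , ab , ac , b≢c) →
      b≢c (trans (only-p b b∈ ab) (≡-sym (only-p c c∈ ac)))) ∄leaf
      where
      only-p : ∀ b → b ∈ A → E F a b → b ≡ p
      only-p b b∈ ab = decidable-stable (b Fin.≟ p) λ b≢p → ∄b (b , b∈ , ab , b≢p)

    -- A non-backtracking walk in A, each position remembering its predecessor.
    walk : ℕ → ∃[ p ] ∃[ a ] a ∈ A
    walk zero    = a₀ , a₀ , a₀∈A
    walk (suc i) with p , a , a∈A ← walk i with b , b∈A , _ ← next p a a∈A = a , b , b∈A

    v : ℕ → V F
    v i = proj₁ (proj₂ (walk i))

    v-edge : ∀ i → E F (v i) (v (suc i))
    v-edge i with p , a , a∈A ← walk i with _ , _ , e , _ ← next p a a∈A = e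

    v-turn : ∀ i → v (suc (suc i)) ≢ v i
    v-turn i with p , a , a∈A ← walk i with b , b∈A , _ ← next p a a∈A
      with _ , _ , _ , c≢a ← next a b b∈A = c≢a

    v-step : ∀ i → v (suc i) ≢ v i
    v-step i eq with () ← trans (≡-sym (irrefl F (v i))) (subst (E F (v i)) eq (v-edge i))

    InjectiveBelow : ℕ → Set
    InjectiveBelow j = ∀ {s t} → s < j → t < j → v s ≡ v t → s ≡ t

    -- The gap between the two equal positions is `suc l`. A gap of one would be a loop and a gap of
    -- two a turn; from three on, the positions from `i` to `j - 1` are distinct and form the cycle.
    cycle : ∀ i l {j} → j ≡ suc l + i → InjectiveBelow j → v i ≡ v j → Cycle F
    cycle i 0 refl inj eq = contradiction (≡-sym eq) (v-step i)
    cycle i 1 refl inj eq = contradiction (≡-sym eq) (v-turn i)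
    cycle i (suc (suc k)) refl inj eq = record
      { k        = k
      ; c        = λ t → v (toℕ t + i)
      ; distinct = λ {s} {t} eq → Fin.toℕ-injective (+-cancelʳ-≡ i _ _
                     (inj (+-monoˡ-< i (Fin.toℕ<n s)) (+-monoˡ-< i (Fin.toℕ<n t)) eq))
      ; consec   = λ s t t≡1+s → subst (λ t → E F (v (toℕ s + i)) (v (t + i))) (≡-sym t≡1+s) (v-edge (toℕ s + i))
      ; closing  = closing′
      }
      where
      closing′ : ∀ s t → toℕ s ≡ suc (suc k) → toℕ t ≡ 0 → E F (v (toℕ s + i)) (v (toℕ t + i))
      closing′ s t s≡ t≡ rewrite s≡ | t≡ = subst (E F (v (suc (suc k) + i))) (≡-sym eq) (v-edge (suc (suc k) + i))

    -- Positions are examined in order, with `d` still to come; more than `n F` distinct ones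
    -- violate the pigeonhole principle.
    search : ∀ d j → d + j ≡ suc (n F) → InjectiveBelow j → Cycle F
    search zero    j refl inj = contradiction
      (Fin.injective⇒≤ {f = v ∘ toℕ {suc (n F)}} λ {s} {t} eq → Fin.toℕ-injective (inj (Fin.toℕ<n s) (Fin.toℕ<n t) eq))
      (<-irrefl refl)
    search (suc d) j d+j≡ inj with Fin.any? (λ (s : Fin j) → v (toℕ s) Fin.≟ v j)
    ... | no ∄s = search d (suc j) (trans (+-suc d j) d+j≡) inj′
      where
      fresh : ∀ {s} → s < j → v s ≢ v j
      fresh s<j eq = ∄s (fromℕ< s<j , trans (cong v (Fin.toℕ-fromℕ< s<j)) eq)
      inj′ : InjectiveBelow (suc j)
      inj′ s<1+j t<1+j eq with m≤n⇒m<n∨m≡n (s≤s⁻¹ s<1+j) | m≤n⇒m<n∨m≡n (s≤s⁻¹ t<1+j)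
      ... | inj₁ s<j  | inj₁ t<j  = inj s<j t<j eq
      ... | inj₁ s<j  | inj₂ refl = contradiction eq (fresh s<j)
      ... | inj₂ refl | inj₁ t<j  = contradiction (≡-sym eq) (fresh t<j)
      ... | inj₂ refl | inj₂ refl = refl
    ... | yes (s , eq) with l , j≡ ← gap (Fin.toℕ<n s) = cycle (toℕ s) l j≡ inj eq

-- Menger's theorem

_[_↦_] : ∀ {m} {T : Set} → (Fin m → T) → Fin m → T → Fin m → T
(g [ a ↦ x ]) b with b Fin.≟ a
... | yes _ = x
... | no _  = g b

module _ (G : Graph) where

  walk-mono : ∀ {A B u v} → A ⊆ B → WalkIn G A u v → WalkIn G B u v
  walk-mono A⊆B (here u∈)     = here (A⊆B u∈)
  walk-mono A⊆B (step u∈ e p) = step (A⊆B u∈) e (walk-mono A⊆B p)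

  walk-++ : ∀ {A u v w} → WalkIn G A u v → WalkIn G A v w → WalkIn G A u w
  walk-++ (here _)      q = q
  walk-++ (step u∈ e p) q = step u∈ e (walk-++ p q)

  walk-reverse : ∀ {A u v} → WalkIn G A u v → WalkIn G A v u
  walk-reverse (here u∈)     = here u∈
  walk-reverse (step u∈ e p) = walk-++ (walk-reverse p) (step (walk-start G p) (E-sym G e) (here u∈))

  connected-⁅⁆ : ∀ x → ConnectedIn G ⁅ x ⁆
  connected-⁅⁆ x u v u∈ v∈ with refl ← x∈⁅y⁆⇒x≡y x u∈ | refl ← x∈⁅y⁆⇒x≡y x v∈ = here u∈

  connected-∪ : ∀ {A B p q} → ConnectedIn G A → ConnectedIn G B → p ∈ A → q ∈ B →
    WalkIn G (A ∪ B) p q → ConnectedIn G (A ∪ B)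
  connected-∪ {A} {B} {p} {q} cA cB p∈A q∈B pq u v u∈ v∈ = walk-++ (to-p u u∈) (walk-reverse (to-p v v∈))
    where
    to-p : ∀ u → u ∈ A ∪ B → WalkIn G (A ∪ B) u p
    to-p u u∈ with ∈-∪⁻ {p = A} u∈
    ... | inj₁ u∈A = walk-mono ∪ˡ (cA u p u∈A p∈A)
    ... | inj₂ u∈B = walk-++ (walk-mono (∪ʳ {p = A}) (cB u q u∈B q∈B)) (walk-reverse pq)

  module _ (B : Subset (n G)) where

    inδ? : ∀ D Z → Decidable (λ v → v ∈ Z × v ∉ D × (v ∈ B ⊎ Exits G Z v))
    inδ? D Z v = (v ∈? Z) ×-dec ¬? (v ∈? D) ×-dec ((v ∈? B) ⊎-dec exits? G Z v)

    -- The vertices of Z outside D from which a path to B avoiding the rest of Z may start.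
    δ : Subset (n G) → Subset (n G) → Subset (n G)
    δ D Z = ⟦ inδ? D Z ⟧

    δ⁺ : ∀ {D Z v} → v ∈ Z → v ∉ D → v ∈ B ⊎ Exits G Z v → v ∈ δ D Z
    δ⁺ {D} {Z} v∈Z v∉D ex = ∈⟦⟧⁺ (inδ? D Z) (v∈Z , v∉D , ex)

    δ⁻ : ∀ {D Z v} → v ∈ δ D Z → v ∈ Z × v ∉ D × (v ∈ B ⊎ Exits G Z v)
    δ⁻ {D} {Z} = ∈⟦⟧⁻ (inδ? D Z)

    exits-anti′ : ∀ {Y Z v} → Y ⊆ Z → v ∈ B ⊎ Exits G Z v → v ∈ B ⊎ Exits G Y v
    exits-anti′ Y⊆Z = [ inj₁ , inj₂ ∘ exits-anti G Y⊆Z ]′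

    -- An edge leaving the intersection leaves one of the two sets, and an edge leaving the union
    -- leaves each set that contains its start; membership in `B` and in `D` does not depend on the
    -- set.
    δ-submodular : ∀ D Y Z → ∣ δ D (Y ∪ Z) ∣ + ∣ δ D (Y ∩ Z) ∣ ≤ ∣ δ D Y ∣ + ∣ δ D Z ∣
    δ-submodular D Y Z = ∣∣-uncross union inter both
      where
      union : ∀ {v} → v ∈ δ D (Y ∪ Z) → v ∈ δ D Y ⊎ v ∈ δ D Z
      union v∈ with v∈∪ , v∉D , ex ← δ⁻ v∈ with ∈-∪⁻ {p = Y} v∈∪
      ... | inj₁ v∈Y = inj₁ (δ⁺ v∈Y v∉D (exits-anti′ ∪ˡ ex))
      ... | inj₂ v∈Z = inj₂ (δ⁺ v∈Z v∉D (exits-anti′ (∪ʳ {p = Y}) ex))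
      inter : ∀ {v} → v ∈ δ D (Y ∩ Z) → v ∈ δ D Y ⊎ v ∈ δ D Z
      inter v∈ with v∈∩ , v∉D , ex ← δ⁻ v∈ with v∈Y , v∈Z ← ∈-∩⁻ {p = Y} v∈∩ with ex
      ... | inj₁ v∈B = inj₁ (δ⁺ v∈Y v∉D (inj₁ v∈B))
      ... | inj₂ (w , w∉ , e) with w ∈? Y
      ...   | no w∉Y  = inj₁ (δ⁺ v∈Y v∉D (inj₂ (w , w∉Y , e)))
      ...   | yes w∈Y = inj₂ (δ⁺ v∈Z v∉D (inj₂ (w , (λ w∈Z → w∉ (x∈p∩q⁺ (w∈Y , w∈Z))) , e)))
      both : ∀ {v} → v ∈ δ D (Y ∪ Z) → v ∈ δ D (Y ∩ Z) → v ∈ δ D Y × v ∈ δ D Z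
      both v∈ v∈′ with _ , v∉D , ex ← δ⁻ v∈ with v∈Y , v∈Z ← ∈-∩⁻ {p = Y} (proj₁ (δ⁻ v∈′)) =
        δ⁺ v∈Y v∉D (exits-anti′ ∪ˡ ex) , δ⁺ v∈Z v∉D (exits-anti′ (∪ʳ {p = Y}) ex)

  module _ {f : ℕ} (A : Subset f) (B Q : Subset (n G)) where

    -- Disjoint paths from the `r a` to `B`, recorded as connected vertex sets since they only serve
    -- to enlarge branch sets. `Q` is the region they stay in, and `meets` keeps them off the rest
    -- of the branch sets inside `X`.
    record Linkage (X : Subset (n G)) (r : Fin f → V G) : Set where
      field
        P           : Fin f → Subset (n G)
        starts      : ∀ {a} → a ∈ A → r a ∈ P a
        ends        : ∀ {a} → a ∈ A → ∃[ v ] v ∈ P a × v ∈ B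
        meets       : ∀ {a v} → a ∈ A → v ∈ P a → v ∈ X → v ≡ r a
        P⊆Q         : ∀ {a} → a ∈ A → P a ⊆ Q
        P-connected : ∀ {a} → a ∈ A → ConnectedIn G (P a)
        P-disjoint  : ∀ {a b v} → a ∈ A → b ∈ A → v ∈ P a → v ∈ P b → a ≡ b

    trivial-linkage : ∀ {X r} → (∀ {a} → a ∈ A → r a ∈ B) → (∀ {a} → a ∈ A → r a ∈ Q) →
      (∀ {a b} → a ∈ A → b ∈ A → r a ≡ r b → a ≡ b) → Linkage X r
    trivial-linkage {X} {r} r∈B r∈Q r-inj = record
      { P           = ⁅_⁆ ∘ r
      ; starts      = λ {a} _ → x∈⁅x⁆ (r a)
      ; ends        = λ {a} a∈A → r a , x∈⁅x⁆ (r a) , r∈B a∈A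
      ; meets       = λ {a} _ v∈P _ → x∈⁅y⁆⇒x≡y (r a) v∈P
      ; P⊆Q         = λ a∈A → ⁅⁆⊆ (r∈Q a∈A)
      ; P-connected = λ {a} _ → connected-⁅⁆ (r a)
      ; P-disjoint  = λ {a} {b} a∈A b∈A v∈a v∈b → r-inj a∈A b∈A
                        (trans (≡-sym (x∈⁅y⁆⇒x≡y (r a) v∈a)) (x∈⁅y⁆⇒x≡y (r b) v∈b))
      }

    -- The path of `a₀` gets `r a₀` in front of `w`. The other paths miss `r a₀`: it lies in `X`,
    -- which they meet only in their own starts, and starts are distinct.
    prepend : ∀ {X r a₀ w} → a₀ ∈ A → (∀ {a} → a ∈ A → r a ∈ X) → (∀ {a} → a ∈ A → r a ∈ Q) →
      (∀ {a b} → a ∈ A → b ∈ A → r a ≡ r b → a ≡ b) → w ∉ X → E G (r a₀) w →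
      Linkage (X ∪ ⁅ w ⁆) (r [ a₀ ↦ w ]) → Linkage X r
    prepend {X} {r} {a₀} {w} a₀∈A r∈X r∈Q r-inj w∉X e L = record
      { P           = P′
      ; starts      = starts′
      ; ends        = ends′
      ; meets       = meets′
      ; P⊆Q         = P⊆Q′
      ; P-connected = connected′
      ; P-disjoint  = disjoint′
      }
      where
      open Linkage L
      x : V G
      x = r a₀

      P′ : Fin f → Subset (n G)
      P′ = P [ a₀ ↦ ⁅ x ⁆ ∪ P a₀ ]

      w∈P : w ∈ P a₀
      w∈P with s ← starts a₀∈A with a₀ Fin.≟ a₀
      ... | yes _ = s
      ... | no ≢ = contradiction refl ≢

      starts′ : ∀ {a} → a ∈ A → r a ∈ P′ a
      starts′ {a} a∈A with s ← starts a∈A with a Fin.≟ a₀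
      ... | yes refl = ∪ˡ (x∈⁅x⁆ x)
      ... | no _     = s

      ends′ : ∀ {a} → a ∈ A → ∃[ v ] v ∈ P′ a × v ∈ B
      ends′ {a} a∈A with v , v∈P , v∈B ← ends a∈A with a Fin.≟ a₀
      ... | yes refl = v , ∪ʳ {p = ⁅ x ⁆} v∈P , v∈B
      ... | no _     = v , v∈P , v∈B

      avoids : ∀ {v} → v ∈ P a₀ → v ∉ X
      avoids v∈P v∈X with v≡ ← meets a₀∈A v∈P (∪ˡ v∈X) with a₀ Fin.≟ a₀
      ... | yes _ = w∉X (subst (_∈ X) v≡ v∈X)
      ... | no ≢ = contradiction refl ≢

      meets′ : ∀ {a v} → a ∈ A → v ∈ P′ a → v ∈ X → v ≡ r a
      meets′ {a} a∈A v∈P′ v∈X with m ← (λ v∈P → meets {a} a∈A v∈P (∪ˡ v∈X)) with a Fin.≟ a₀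
      ... | no _ = m v∈P′
      ... | yes refl with ∈-∪⁻ {p = ⁅ x ⁆} v∈P′
      ...   | inj₁ v∈x = x∈⁅y⁆⇒x≡y x v∈x
      ...   | inj₂ v∈P = contradiction v∈X (avoids v∈P)

      P⊆Q′ : ∀ {a} → a ∈ A → P′ a ⊆ Q
      P⊆Q′ {a} a∈A with a Fin.≟ a₀
      ... | yes refl = ∪-lub (⁅⁆⊆ (r∈Q a₀∈A)) (P⊆Q a₀∈A)
      ... | no _     = P⊆Q a∈A

      connected′ : ∀ {a} → a ∈ A → ConnectedIn G (P′ a)
      connected′ {a} a∈A with a Fin.≟ a₀
      ... | yes refl = connected-∪ (connected-⁅⁆ x) (P-connected a₀∈A) (x∈⁅x⁆ x) w∈P
                         (step (∪ˡ (x∈⁅x⁆ x)) e (here (∪ʳ {p = ⁅ x ⁆} w∈P)))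
      ... | no _     = P-connected a∈A

      x∉P : ∀ {a} → a ∈ A → a ≢ a₀ → x ∉ P a
      x∉P {a} a∈A a≢a₀ x∈P with x≡ ← meets a∈A x∈P (∪ˡ (r∈X a₀∈A)) with a Fin.≟ a₀
      ... | yes eq = contradiction eq a≢a₀
      ... | no _   = a≢a₀ (r-inj a∈A a₀∈A (≡-sym x≡))

      disjoint₀ : ∀ {b v} → b ∈ A → b ≢ a₀ → v ∈ ⁅ x ⁆ ∪ P a₀ → v ∉ P b
      disjoint₀ {b} b∈A b≢a₀ v∈ v∈Pb with ∈-∪⁻ {p = ⁅ x ⁆} v∈
      ... | inj₁ v∈x = x∉P b∈A b≢a₀ (subst (_∈ P b) (x∈⁅y⁆⇒x≡y x v∈x) v∈Pb)
      ... | inj₂ v∈P = b≢a₀ (P-disjoint b∈A a₀∈A v∈Pb v∈P)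

      disjoint′ : ∀ {a b v} → a ∈ A → b ∈ A → v ∈ P′ a → v ∈ P′ b → a ≡ b
      disjoint′ {a} {b} a∈A b∈A v∈a v∈b with a Fin.≟ a₀ | b Fin.≟ a₀
      ... | yes refl | yes refl = refl
      ... | yes refl | no b≢a₀  = contradiction v∈b (disjoint₀ b∈A b≢a₀ v∈a)
      ... | no a≢a₀  | yes refl = contradiction v∈a (disjoint₀ a∈A a≢a₀ v∈b)
      ... | no _     | no _     = P-disjoint a∈A b∈A v∈a v∈b

    -- Menger's theorem, with cuts given as boundaries of supersets of X. Advance the start x of
    -- one path to a neighbour w outside a maximal Z ⊇ X that becomes deficient when x is deleted;
    -- by submodularity no superset of X containing w is deficient after deleting x.
    menger : (∀ {x w} → x ∈ Q → x ∉ B → E G x w → w ∈ Q) → ∀ d D X r → ∣ ∁ X ∣ ≤ d →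
      (∀ Z → X ⊆ Z → ∣ A ∣ ≤ ∣ δ B D Z ∣) → ∣ δ B D X ∣ ≤ ∣ A ∣ →
      (∀ {a} → a ∈ A → r a ∈ δ B D X) → (∀ {a} → a ∈ A → r a ∈ Q) →
      (∀ {a b} → a ∈ A → b ∈ A → r a ≡ r b → a ≡ b) → Linkage X r
    menger closed d D X r ∁X≤d large tight r∈δ r∈Q r-inj
      with Fin.any? (λ a → (a ∈? A) ×-dec ¬? (r a ∈? B))
    ... | no ∄a = trivial-linkage
      (λ {a} a∈A → decidable-stable (r a ∈? B) λ r∉B → ∄a (a , a∈A , r∉B)) r∈Q r-inj
    ... | yes (a₀ , a₀∈A , x∉B) = advance (maximal⊇ deficient? deficient-X)
      where
      x : V G
      x = r a₀
      D′ : Subset (n G)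
      D′ = D ∪ ⁅ x ⁆

      deficient? : Decidable (λ Z → ∣ δ B D′ Z ∣ < ∣ A ∣)
      deficient? Z = ∣ δ B D′ Z ∣ <? ∣ A ∣

      ∉D′ : ∀ {v} → v ∉ D → v ≢ x → v ∉ D′
      ∉D′ v∉D v≢x v∈ with ∈-∪⁻ {p = D} v∈
      ... | inj₁ v∈D = v∉D v∈D
      ... | inj₂ v∈x = v≢x (x∈⁅y⁆⇒x≡y x v∈x)

      ∉D′⇒≢x : ∀ {v} → v ∉ D′ → v ≢ x
      ∉D′⇒≢x v∉D′ refl = v∉D′ (∪ʳ {p = D} (x∈⁅x⁆ x))

      ∣δX-x∣< : ∣ δ B D X - x ∣ < ∣ A ∣
      ∣δX-x∣< = ≤-trans (x∈p⇒∣p-x∣<∣p∣ (r∈δ a₀∈A)) tight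

      deficient-X : ∣ δ B D′ X ∣ < ∣ A ∣
      deficient-X = ≤-trans (s≤s (p⊆q⇒∣p∣≤∣q∣ ⊆X)) ∣δX-x∣<
        where
        ⊆X : δ B D′ X ⊆ δ B D X - x
        ⊆X v∈ with v∈X , v∉D′ , ex ← δ⁻ B v∈ = x∈p∧x≢y⇒x∈p-y (δ⁺ B v∈X (v∉D′ ∘ ∪ˡ) ex) (∉D′⇒≢x v∉D′)

      δ⊆δ′ : ∀ {Z} → δ B D Z ⊆ δ B D′ Z ∪ ⁅ x ⁆
      δ⊆δ′ {Z} {v} v∈ with v Fin.≟ x
      ... | yes refl = ∪ʳ {p = δ B D′ Z} (x∈⁅x⁆ x)
      ... | no v≢x with v∈Z , v∉D , ex ← δ⁻ B v∈ = ∪ˡ (δ⁺ B v∈Z (∉D′ v∉D v≢x) ex)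

      nearly-large : ∀ Z → X ⊆ Z → ∣ A ∣ ≤ suc ∣ δ B D′ Z ∣
      nearly-large Z X⊆Z = ≤-trans (large Z X⊆Z) (≤-trans (p⊆q⇒∣p∣≤∣q∣ δ⊆δ′) (∣∪⁅⁆∣≤ (δ B D′ Z) x))

      -- Deleting `x` costs `Y ∩ Z` at most one, so it still counts at least `∣ A ∣` minus one; `Y`
      -- and `Z` count at most that, and by submodularity so does the union.
      deficient-∪ : ∀ {Y Z} → X ⊆ Y → X ⊆ Z → ∣ δ B D′ Y ∣ < ∣ A ∣ → ∣ δ B D′ Z ∣ < ∣ A ∣ → ∣ δ B D′ (Y ∪ Z) ∣ < ∣ A ∣
      deficient-∪ {Y} {Z} X⊆Y X⊆Z Y< Z< = +-cancelʳ-≤ (∣ δ B D′ (Y ∩ Z) ∣) _ _ (begin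
        suc (∣ δ B D′ (Y ∪ Z) ∣ + ∣ δ B D′ (Y ∩ Z) ∣) ≤⟨ s≤s (δ-submodular B D′ Y Z) ⟩
        suc ∣ δ B D′ Y ∣ + ∣ δ B D′ Z ∣              ≤⟨ +-mono-≤ Y< (s≤s⁻¹ (≤-trans Z< (nearly-large (Y ∩ Z) λ v∈X → x∈p∩q⁺ (X⊆Y v∈X , X⊆Z v∈X)))) ⟩
        ∣ A ∣ + ∣ δ B D′ (Y ∩ Z) ∣                 ∎)
        where open ≤-Reasoning

      advance : ∃[ Z ] X ⊆ Z × ∣ δ B D′ Z ∣ < ∣ A ∣ × (∀ Y → Z ⊆ Y → ∣ δ B D′ Y ∣ < ∣ A ∣ → Y ⊆ Z) → Linkage X r
      advance (Z , X⊆Z , Z< , Z-max) = step-to (decidable-stable (exits? G Z x) ¬¬exits)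
        where
        -- As `x` is not in `B`, without an exit it would not be counted in `δ B D Z` at all; its
        -- deletion would cost nothing and `Z` would not be deficient.
        ¬¬exits : ¬ ¬ Exits G Z x
        ¬¬exits ¬ex = <⇒≱ Z< (≤-trans (large Z X⊆Z) (p⊆q⇒∣p∣≤∣q∣ ⊆δ′))
          where
          ⊆δ′ : δ B D Z ⊆ δ B D′ Z
          ⊆δ′ v∈ with v∈Z , v∉D , ex ← δ⁻ B v∈ = δ⁺ B v∈Z (∉D′ v∉D λ { refl → [ x∉B , ¬ex ]′ ex }) ex

        step-to : Exits G Z x → Linkage X r
        step-to (w , w∉Z , e) = prepend a₀∈A (proj₁ ∘ δ⁻ B ∘ r∈δ) r∈Q r-inj (w∉Z ∘ X⊆Z) e
          (recurse d ∁X≤d)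
          where
          X′ : Subset (n G)
          X′ = X ∪ ⁅ w ⁆
          w∈X′ : w ∈ X′
          w∈X′ = ∪ʳ {p = X} (x∈⁅x⁆ w)

          large′ : ∀ Y → X′ ⊆ Y → ∣ A ∣ ≤ ∣ δ B D′ Y ∣
          large′ Y X′⊆Y = ≮⇒≥ λ Y< → w∉Z (Z-max (Z ∪ Y) ∪ˡ
            (deficient-∪ X⊆Z (⊆-trans ∪ˡ X′⊆Y) Z< Y<) (∪ʳ {p = Z} (X′⊆Y w∈X′)))

          δX′⊆ : δ B D′ X′ ⊆ (δ B D X - x) ∪ ⁅ w ⁆
          δX′⊆ v∈ with v∈X′ , v∉D′ , ex ← δ⁻ B v∈ with ∈-∪⁻ {p = X} v∈X′
          ... | inj₁ v∈X = ∪ˡ (x∈p∧x≢y⇒x∈p-y (δ⁺ B v∈X (v∉D′ ∘ ∪ˡ) (exits-anti′ B ∪ˡ ex)) (∉D′⇒≢x v∉D′))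
          ... | inj₂ v∈w = ∪ʳ {p = δ B D X - x} v∈w

          bound : ∣ (δ B D X - x) ∪ ⁅ w ⁆ ∣ ≤ ∣ A ∣
          bound = ≤-trans (∣∪⁅⁆∣≤ (δ B D X - x) w) ∣δX-x∣<

          -- The left side has at most `∣ A ∣` elements and the right side at least that many, so
          -- the inclusion `δX′⊆` is an equality and all new starts are counted.
          δX′⊇ : (δ B D X - x) ∪ ⁅ w ⁆ ⊆ δ B D′ X′
          δX′⊇ = ⊆∧∣∣≤⇒⊇ δX′⊆ (≤-trans bound (large′ X′ ⊆-refl))

          r′ : Fin f → V G
          r′ = r [ a₀ ↦ w ]

          r′∈δ : ∀ {a} → a ∈ A → r′ a ∈ δ B D′ X′
          r′∈δ {a} a∈A with a Fin.≟ a₀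
          ... | yes _   = δX′⊇ (∪ʳ {p = δ B D X - x} (x∈⁅x⁆ w))
          ... | no a≢a₀ = δX′⊇ (∪ˡ (x∈p∧x≢y⇒x∈p-y (r∈δ a∈A) λ eq → a≢a₀ (r-inj a∈A a₀∈A eq)))

          r′∈Q : ∀ {a} → a ∈ A → r′ a ∈ Q
          r′∈Q {a} a∈A with a Fin.≟ a₀
          ... | yes _ = closed (r∈Q a₀∈A) x∉B e
          ... | no _  = r∈Q a∈A

          r≢w : ∀ {a} → a ∈ A → r a ≢ w
          r≢w a∈A eq = w∉Z (X⊆Z (subst (_∈ X) eq (proj₁ (δ⁻ B (r∈δ a∈A)))))

          r′-inj : ∀ {a b} → a ∈ A → b ∈ A → r′ a ≡ r′ b → a ≡ b
          r′-inj {a} {b} a∈A b∈A eq with a Fin.≟ a₀ | b Fin.≟ a₀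
          ... | yes refl | yes refl = refl
          ... | yes refl | no _     = contradiction (≡-sym eq) (r≢w b∈A)
          ... | no _     | yes refl = contradiction eq (r≢w a∈A)
          ... | no _     | no _     = r-inj a∈A b∈A eq

          ∁X′<∁X : ∣ ∁ X′ ∣ < ∣ ∁ X ∣
          ∁X′<∁X = p⊂q⇒∣p∣<∣q∣ (p⊂q⇒∁p⊃∁q (∪ˡ , w , w∈X′ , w∉Z ∘ X⊆Z))

          recurse : ∀ d → ∣ ∁ X ∣ ≤ d → Linkage X′ r′
          recurse zero    ∁X≤d = contradiction (≤-trans ∁X′<∁X ∁X≤d) λ ()
          recurse (suc d) ∁X≤d = menger closed d D′ X′ r′ (s≤s⁻¹ (≤-trans ∁X′<∁X ∁X≤d))
            large′ (≤-trans (p⊆q⇒∣p∣≤∣q∣ δX′⊆) bound) r′∈δ r′∈Q r′-inj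

-- Growing the model

-- The bound on the bags: at most `m` plus at most `m - 1`, in the form width plus one for the width
-- `2 * m ∸ 2`.
+≤1+[2*∸2] : ∀ {i j m} → i ≤ m → j < m → i + j ≤ suc (2 * m ∸ 2)
+≤1+[2*∸2] {m = suc m} i≤m (s≤s j≤m) rewrite +-suc m (m + 0) | +-identityʳ m = +-mono-≤ i≤m j≤m

module _ (F G : Graph) where

  -- A model of F[A] in G[X] whose branch sets all have a vertex, their tip, in T.
  record Model (A : Subset (n F)) (X T : Subset (n G)) : Set where
    field
      B           : V F → Subset (n G)
      tip         : V F → V G
      B⊆X         : ∀ {a} → a ∈ A → B a ⊆ X
      tip∈B       : ∀ {a} → a ∈ A → tip a ∈ B a
      tip∈T       : ∀ {a} → a ∈ A → tip a ∈ T
      B-disjoint  : ∀ {a b v} → a ∈ A → b ∈ A → v ∈ B a → v ∈ B b → a ≡ b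
      B-connected : ∀ {a} → a ∈ A → ConnectedIn G (B a)
      B-edges     : ∀ {a b} → a ∈ A → b ∈ A → E F a b → ∃[ u ] ∃[ v ] u ∈ B a × v ∈ B b × E G u v

    tip-injective : ∀ {a b} → a ∈ A → b ∈ A → tip a ≡ tip b → a ≡ b
    tip-injective a∈A b∈A eq = B-disjoint a∈A b∈A (tip∈B a∈A) (subst (_∈ B _) (≡-sym eq) (tip∈B b∈A))

  open Model

  retarget : ∀ {A X T T′} → T ⊆ T′ → Model A X T → Model A X T′
  retarget T⊆T′ M = record { Model M hiding (tip∈T) ; tip∈T = λ a∈A → T⊆T′ (tip∈T M a∈A) }

  empty-model : ∀ {A X T} → V G → Empty A → Model A X T
  empty-model {A} v₀ ∅A = record
    { B           = λ _ → ⊥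
    ; tip         = λ _ → v₀
    ; B⊆X         = absurd
    ; tip∈B       = absurd
    ; tip∈T       = absurd
    ; B-disjoint  = λ a∈A → absurd a∈A
    ; B-connected = absurd
    ; B-edges     = λ a∈A → absurd a∈A
    }
    where
    absurd : ∀ {W : Set} {a} → a ∈ A → W
    absurd {a = a} a∈A = contradiction (a , a∈A) ∅A

  rooted-model : ∀ {X S} → Model ⊤ X S → RootedModel F G S
  rooted-model M = record
    { B         = B M
    ; disjoint  = λ a b a≢b v v∈a v∈b → a≢b (B-disjoint M ∈⊤ ∈⊤ v∈a v∈b)
    ; nonempty  = λ a → tip M a , tip∈B M ∈⊤
    ; connected = λ a → B-connected M ∈⊤
    ; edges     = λ a b → B-edges M ∈⊤ ∈⊤
    ; rooted    = λ a → tip M a , tip∈B M ∈⊤ , tip∈T M ∈⊤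
    }

  -- Each branch set absorbs the path from its tip. The branch sets lie in `X`, which a path meets
  -- only in its start, so they remain disjoint.
  extend-model : ∀ {A X Q T T′} (M : Model A X T) → X ⊆ Q → Linkage G A T′ Q X (tip M) → Model A Q T′
  extend-model {A} {X} {Q} {T} {T′} M X⊆Q L = record
    { B           = B′
    ; tip         = tip′
    ; B⊆X         = λ a∈A → ∪-lub (⊆-trans (B⊆X M a∈A) X⊆Q) (P⊆Q a∈A)
    ; tip∈B       = λ {a} a∈A → ∪ʳ {p = B M a} (proj₁ (tip′-spec a∈A))
    ; tip∈T       = λ a∈A → proj₂ (tip′-spec a∈A)
    ; B-disjoint  = disjoint′
    ; B-connected = λ {a} a∈A → connected-∪ G (B-connected M a∈A) (P-connected a∈A) (tip∈B M a∈A) (starts a∈A)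
                      (here (∪ˡ (tip∈B M a∈A)))
    ; B-edges     = edges′
    }
    where
    open Linkage L
    B′ : V F → Subset (n G)
    B′ a = B M a ∪ P a

    tip′ : V F → V G
    tip′ a with a ∈? A
    ... | yes a∈A = proj₁ (ends a∈A)
    -- A default value: `ends` speaks only of `a` in `A`.
    ... | no _    = tip M a

    tip′-spec : ∀ {a} → a ∈ A → tip′ a ∈ P a × tip′ a ∈ T′
    tip′-spec {a} a∈A with a ∈? A
    ... | yes a∈A = proj₂ (ends a∈A)
    ... | no a∉A  = contradiction a∈A a∉A

    cross : ∀ {a b v} → a ∈ A → b ∈ A → v ∈ B M a → v ∈ P b → a ≡ b
    cross {a} {b} a∈A b∈A v∈B v∈P =
      B-disjoint M a∈A b∈A v∈B (subst (_∈ B M b) (≡-sym (meets b∈A v∈P (B⊆X M a∈A v∈B))) (tip∈B M b∈A))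

    disjoint′ : ∀ {a b v} → a ∈ A → b ∈ A → v ∈ B′ a → v ∈ B′ b → a ≡ b
    disjoint′ {a} {b} a∈A b∈A v∈a v∈b with ∈-∪⁻ {p = B M a} v∈a | ∈-∪⁻ {p = B M b} v∈b
    ... | inj₁ v∈Ba | inj₁ v∈Bb = B-disjoint M a∈A b∈A v∈Ba v∈Bb
    ... | inj₁ v∈Ba | inj₂ v∈Pb = cross a∈A b∈A v∈Ba v∈Pb
    ... | inj₂ v∈Pa | inj₁ v∈Bb = ≡-sym (cross b∈A a∈A v∈Bb v∈Pa)
    ... | inj₂ v∈Pa | inj₂ v∈Pb = P-disjoint a∈A b∈A v∈Pa v∈Pb

    edges′ : ∀ {a b} → a ∈ A → b ∈ A → E F a b → ∃[ u ] ∃[ v ] u ∈ B′ a × v ∈ B′ b × E G u v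
    edges′ a∈A b∈A ab with u , v , u∈ , v∈ , uv ← B-edges M a∈A b∈A ab = u , v , ∪ˡ u∈ , ∪ˡ v∈ , uv

  -- The new branch set is `y` alone, joined to the branch sets of the neighbours of `a` through
  -- their tips.
  add-vertex : ∀ {A X T a y} → a ∈ A → y ∉ X → (M : Model (A - a) X T) →
    (∀ {b} → b ∈ A - a → E F a b → E G (tip M b) y) → Model A (X ∪ ⁅ y ⁆) (T ∪ ⁅ y ⁆)
  add-vertex {A} {X} {T} {a} {y} a∈A y∉X M e = record
    { B           = B′
    ; tip         = tip M [ a ↦ y ]
    ; B⊆X         = B′⊆
    ; tip∈B       = tip∈B′
    ; tip∈T       = tip∈T′
    ; B-disjoint  = disjoint′
    ; B-connected = connected′
    ; B-edges     = edges′
    }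
    where
    B′ : V F → Subset (n G)
    B′ = B M [ a ↦ ⁅ y ⁆ ]

    old : ∀ {b} → b ∈ A → b ≢ a → b ∈ A - a
    old = x∈p∧x≢y⇒x∈p-y

    B′⊆ : ∀ {b} → b ∈ A → B′ b ⊆ X ∪ ⁅ y ⁆
    B′⊆ {b} b∈A with b Fin.≟ a
    ... | yes _  = ∪ʳ {p = X}
    ... | no b≢a = ⊆-trans (B⊆X M (old b∈A b≢a)) ∪ˡ

    tip∈B′ : ∀ {b} → b ∈ A → (tip M [ a ↦ y ]) b ∈ B′ b
    tip∈B′ {b} b∈A with b Fin.≟ a
    ... | yes _  = x∈⁅x⁆ y
    ... | no b≢a = tip∈B M (old b∈A b≢a)

    tip∈T′ : ∀ {b} → b ∈ A → (tip M [ a ↦ y ]) b ∈ T ∪ ⁅ y ⁆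
    tip∈T′ {b} b∈A with b Fin.≟ a
    ... | yes _  = ∪ʳ {p = T} (x∈⁅x⁆ y)
    ... | no b≢a = ∪ˡ (tip∈T M (old b∈A b≢a))

    connected′ : ∀ {b} → b ∈ A → ConnectedIn G (B′ b)
    connected′ {b} b∈A with b Fin.≟ a
    ... | yes _  = connected-⁅⁆ G y
    ... | no b≢a = B-connected M (old b∈A b≢a)

    y∉B : ∀ {b v} → b ∈ A - a → v ∈ ⁅ y ⁆ → v ∉ B M b
    y∉B b∈ v∈y v∈B with refl ← x∈⁅y⁆⇒x≡y y v∈y = y∉X (B⊆X M b∈ v∈B)

    disjoint′ : ∀ {b c v} → b ∈ A → c ∈ A → v ∈ B′ b → v ∈ B′ c → b ≡ c
    disjoint′ {b} {c} b∈A c∈A v∈b v∈c with b Fin.≟ a | c Fin.≟ a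
    ... | yes refl | yes refl = refl
    ... | yes refl | no c≢a   = contradiction v∈c (y∉B (old c∈A c≢a) v∈b)
    ... | no b≢a   | yes refl = contradiction v∈b (y∉B (old b∈A b≢a) v∈c)
    ... | no b≢a   | no c≢a   = B-disjoint M (old b∈A b≢a) (old c∈A c≢a) v∈b v∈c

    edges′ : ∀ {b c} → b ∈ A → c ∈ A → E F b c → ∃[ u ] ∃[ v ] u ∈ B′ b × v ∈ B′ c × E G u v
    edges′ {b} {c} b∈A c∈A bc with b Fin.≟ a | c Fin.≟ a
    ... | yes refl | yes refl with () ← trans (≡-sym (irrefl F b)) bc
    edges′ {b} {c} b∈A c∈A bc | yes refl | no c≢a =
      y , tip M c , x∈⁅x⁆ y , tip∈B M c∈ , E-sym G (e c∈ bc)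
      where c∈ = old c∈A c≢a
    edges′ {b} {c} b∈A c∈A bc | no b≢a | yes refl =
      tip M b , y , tip∈B M b∈ , x∈⁅x⁆ y , e b∈ (E-sym F bc)
      where b∈ = old b∈A b≢a
    edges′ {b} {c} b∈A c∈A bc | no b≢a | no c≢a = B-edges M (old b∈A b≢a) (old c∈A c≢a) bc

-- Stages of the construction, one vertex of the forest at a time.

module _ (F G : Graph) (S : Subset (n G)) (¬good : ¬ Good G S (suc (2 * n F ∸ 2)) ⊤) where

  open Model

  private
    k : ℕ
    k = suc (2 * n F ∸ 2)

    Good′ : Subset (n G) → Set
    Good′ = Good G S k

  -- The tips are distinct members of `∂ G X`, so by `small` they make up the whole boundary. The
  -- next stage is built from `maximal`, the final linkage to `S` from `floor`.
  record Stage (A : Subset (n F)) : Set where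
    field
      X       : Subset (n G)
      good    : Good′ X
      small   : ∣ ∂ G X ∣ ≤ ∣ A ∣
      floor   : ∀ {Z} → Good′ Z → X ⊆ Z → ∣ A ∣ ≤ ∣ ∂ G Z ∣
      maximal : ∀ Z → X ⊆ Z → Good′ Z × ∣ ∂ G Z ∣ ≤ ∣ A ∣ → Z ⊆ X
      model   : Model F G A X (∂ G X)

  candidate? : ∀ (A : Subset (n F)) → Decidable (λ Z → Good′ Z × ∣ ∂ G Z ∣ ≤ ∣ A ∣)
  candidate? A Z = good? G S k Z ×-dec (∣ ∂ G Z ∣ ≤? ∣ A ∣)

  outsider : ∀ {X} → Good′ X → ∃[ y ] y ∉ X
  outsider {X} gX with Fin.any? (λ y → ¬? (y ∈? X))
  ... | yes found = found
  ... | no ∄y = contradiction (subst Good′ (⊆-antisym ⊆⊤ ⊤⊆X) gX) ¬good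
    where
    ⊤⊆X : ⊤ ⊆ X
    ⊤⊆X {y} _ = decidable-stable (y ∈? X) λ y∉X → ∄y (y , y∉X)

  first-stage : ∀ {A} → Empty A → Stage A
  first-stage {A} ∅A with X , _ , (gX , small) , maximal ← maximal⊇ (candidate? A) {⊥}
    (start , ≤-trans (p⊆q⇒∣p∣≤∣q∣ {q = ⊥} (proj₁ ∘ ∂⁻ G)) (≤-trans (≤-reflexive (∣⊥∣≡0 (n G))) z≤n)) = record
      { X       = X
      ; good    = gX
      ; small   = small
      ; floor   = λ _ _ → ≤-trans (≤-reflexive (trans (cong ∣_∣ (Empty-unique ∅A)) (∣⊥∣≡0 (n F)))) z≤n
      ; maximal = maximal
      -- The default tip: a vertex exists because `X` is good and `⊤` is not.
      ; model   = empty-model F G (proj₁ (outsider gX)) ∅A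
      }

  module _ {A : Subset (n F)} {a : V F} (a∈A : a ∈ A) (leaf : LeafIn F A a) (s : Stage (A - a)) where

    open Stage s

    -- A leaf has at most one neighbour `p` in `A - a`, and the tip of `p` is on the boundary of
    -- `X`, so it has a neighbour outside. If there is no such `p`, any vertex outside `X` will do.
    attach : ∃[ y ] y ∉ X × (∀ {b} → b ∈ A - a → E F a b → E G (tip model b) y)
    attach with Fin.any? (λ p → (p ∈? A - a) ×-dec E? F a p)
    ... | no ∄p = let y , y∉X = outsider good in
      y , y∉X , λ {b} b∈ ab → contradiction (b , b∈ , ab) ∄p
    ... | yes (p , p∈ , ap) with _ , y , y∉X , e ← ∂⁻ G (tip∈T model p∈) =
      y , y∉X , λ b∈ ab →
        subst (λ b → E G (tip model b) y) (leaf p _ (proj₁ (∈-─⁻ {p = A} p∈)) (proj₁ (∈-─⁻ {p = A} b∈)) ap ab) e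

    next-stage : Stage A
    next-stage with y , y∉X , e ← attach = at-maximal (maximal⊇ (candidate? A) (good-X′ , small-X′))
      where
      X′ : Subset (n G)
      X′ = X ∪ ⁅ y ⁆

      ∣∂X∪y∣≤ : ∣ ∂ G X ∪ ⁅ y ⁆ ∣ ≤ ∣ A ∣
      ∣∂X∪y∣≤ = ≤-trans (∣∪⁅⁆∣≤ (∂ G X) y) (≤-trans (s≤s small) (≤-reflexive (∣-∣≡ a∈A)))

      small-X′ : ∣ ∂ G X′ ∣ ≤ ∣ A ∣
      small-X′ = ≤-trans (p⊆q⇒∣p∣≤∣q∣ (∂∪⁅⁆⊆ G X y)) ∣∂X∪y∣≤

      bag⊆ : bag G S X X′ ⊆ ∂ G X ∪ ⁅ y ⁆
      bag⊆ v∈ with bag⁻ G S v∈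
      ... | lower v∈∂ = ∪ˡ v∈∂
      ... | upper v∈∂ = ∂∪⁅⁆⊆ G X y v∈∂
      ... | root _ v∈X′ v∉X with ∈-∪⁻ {p = X} v∈X′
      ...   | inj₁ v∈X = contradiction v∈X v∉X
      ...   | inj₂ v∈y = ∪ʳ {p = ∂ G X} v∈y

      good-X′ : Good′ X′
      good-X′ = grow good ∪ˡ (≤-trans (p⊆q⇒∣p∣≤∣q∣ bag⊆) (≤-trans ∣∂X∪y∣≤ ∣A∣≤k))

        where
        ∣A∣≤k : ∣ A ∣ ≤ k
        ∣A∣≤k = subst (_≤ k) (+-identityʳ ∣ A ∣)
          (+≤1+[2*∸2] (∣p∣≤n A) (≤-trans (s≤s z≤n) (≤-trans (x∈p⇒∣p-x∣<∣p∣ a∈A) (∣p∣≤n A))))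

      -- With a smaller boundary, `Z` would have been a candidate at the previous stage; maximality
      -- would put it inside `X`, although it contains `y`.
      above : ∀ {Z} → Good′ Z → X′ ⊆ Z → ∣ A ∣ ≤ ∣ ∂ G Z ∣
      above {Z} gZ X′⊆Z = ≮⇒≥ λ ∂Z<A → y∉X
        (maximal Z (⊆-trans ∪ˡ X′⊆Z) (gZ , s≤s⁻¹ (≤-trans ∂Z<A (≤-reflexive (≡-sym (∣-∣≡ a∈A)))))
          (X′⊆Z (∪ʳ {p = X} (x∈⁅x⁆ y))))

      -- By `above` the boundary of `X′` is too large to lose anything, so the old tips and `y` are
      -- all still on it.
      ∂X∪y⊆ : ∂ G X ∪ ⁅ y ⁆ ⊆ ∂ G X′
      ∂X∪y⊆ = ⊆∧∣∣≤⇒⊇ (∂∪⁅⁆⊆ G X y) (≤-trans ∣∂X∪y∣≤ (above good-X′ ⊆-refl))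

      model′ : Model F G A X′ (∂ G X′)
      model′ = retarget F G ∂X∪y⊆ (add-vertex F G a∈A y∉X model e)

      at-maximal : ∃[ Y ] X′ ⊆ Y × (Good′ Y × ∣ ∂ G Y ∣ ≤ ∣ A ∣) ×
        (∀ Z → Y ⊆ Z → Good′ Z × ∣ ∂ G Z ∣ ≤ ∣ A ∣ → Z ⊆ Y) → Stage A
      at-maximal (Y , X′⊆Y , (gY , small-Y) , maximal-Y) = record
        { X       = Y
        ; good    = gY
        ; small   = small-Y
        ; floor   = λ gZ Y⊆Z → above gZ (⊆-trans X′⊆Y Y⊆Z)
        ; maximal = maximal-Y
        ; model   = extend-model F G model′ X′⊆Y linkage
        }
        where
        -- `Z` itself need not be good. A set of least boundary between `X′` and `Y` is good by
        -- uncrossing, and its boundary is no larger than that of `Z`.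
        between : ∀ Z → X′ ⊆ Z → Z ⊆ Y → ∣ A ∣ ≤ ∣ ∂ G Z ∣
        between Z X′⊆Z Z⊆Y
          with W , (X′⊆W , W⊆Y) , min ← argmin (λ W → (X′ ⊆? W) ×-dec (W ⊆? Y)) (λ W → ∣ ∂ G W ∣) {Z} (X′⊆Z , Z⊆Y) =
          ≤-trans (above (good-minimal G S k gY W⊆Y λ U W⊆U U⊆Y → min U (⊆-trans X′⊆W W⊆U , U⊆Y)) X′⊆W)
            (min Z (X′⊆Z , Z⊆Y))

        δ′ : Subset (n G) → Subset (n G)
        δ′ = δ G (∂ G Y) ⊥

        closed : ∀ {x w} → x ∈ Y → x ∉ ∂ G Y → E G x w → w ∈ Y
        closed {w = w} x∈Y x∉∂ e = decidable-stable (w ∈? Y) λ w∉Y → x∉∂ (∂⁺ G x∈Y (w , w∉Y , e))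

        -- `Z` may reach beyond `Y`. An edge that leaves `Z ∩ Y` but stays in `Z` leaves `Y`, so its
        -- start already lies in the target `∂ G Y`.
        ∂∩⊆ : ∀ {Z} → ∂ G (Z ∩ Y) ⊆ δ′ Z
        ∂∩⊆ {Z} v∈∂ with v∈ , w , w∉ , e ← ∂⁻ G v∈∂ with v∈Z , v∈Y ← ∈-∩⁻ {p = Z} v∈ with w ∈? Z
        ... | no w∉Z  = δ⁺ G (∂ G Y) v∈Z ∉⊥ (inj₂ (w , w∉Z , e))
        ... | yes w∈Z = δ⁺ G (∂ G Y) v∈Z ∉⊥ (inj₁ (∂⁺ G v∈Y (w , (λ w∈Y → w∉ (x∈p∩q⁺ (w∈Z , w∈Y))) , e)))

        large : ∀ Z → X′ ⊆ Z → ∣ A ∣ ≤ ∣ δ′ Z ∣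
        large Z X′⊆Z = ≤-trans (between (Z ∩ Y) (λ v∈ → x∈p∩q⁺ (X′⊆Z v∈ , X′⊆Y v∈)) (p∩q⊆q Z Y))
          (p⊆q⇒∣p∣≤∣q∣ ∂∩⊆)

        δX′⊆ : δ′ X′ ⊆ ∂ G X′
        δX′⊆ v∈ with v∈X′ , _ , ex ← δ⁻ G (∂ G Y) v∈ =
          ∂⁺ G v∈X′ ([ (λ v∈∂Y → exits-anti G X′⊆Y (proj₂ (∂⁻ G v∈∂Y))) , (λ ex → ex) ]′ ex)

        ∂X′⊆ : ∂ G X′ ⊆ δ′ X′
        ∂X′⊆ v∈∂ with v∈X′ , ex ← ∂⁻ G v∈∂ = δ⁺ G (∂ G Y) v∈X′ ∉⊥ (inj₂ ex)

        linkage : Linkage G A (∂ G Y) Y X′ (tip model′)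
        linkage = menger G A (∂ G Y) Y closed _ ⊥ X′ (tip model′) ≤-refl large
          (≤-trans (p⊆q⇒∣p∣≤∣q∣ δX′⊆) small-X′) (∂X′⊆ ∘ tip∈T model′)
          (λ b∈A → X′⊆Y (B⊆X model′ b∈A (tip∈B model′ b∈A))) (tip-injective model′)

  stage : Forest F → ∀ A → Stage A
  stage forest A = go _ A ≤-refl
    where
    go : ∀ d A → ∣ A ∣ ≤ d → Stage A
    go d A A≤d with nonempty? A
    ... | no ∅A = first-stage ∅A
    ... | yes ne with a , a∈A , leaf ← forest-leaf forest A ne with d
    ...   | zero  = contradiction (≤-trans (x∈p⇒∣p-x∣<∣p∣ a∈A) A≤d) λ ()
    ...   | suc d = next-stage a∈A leaf (go d (A - a) (s≤s⁻¹ (≤-trans (x∈p⇒∣p-x∣<∣p∣ a∈A) A≤d)))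

  -- Linking the complete model to the roots.

  root-model : Stage ⊤ → RootedModel F G S
  root-model s = rooted-model F G (extend-model F G model ⊆⊤ linkage)
    where
    open Stage s
    -- The interior of `X` counts as deleted. Then `δ′ X` lies in the boundary of `X`, and roots in
    -- the interior are left out, as they are in the bag of `X` and `Z`.
    D : Subset (n G)
    D = X ─ ∂ G X

    δ′ : Subset (n G) → Subset (n G)
    δ′ = δ G S D

    ∂Z⊆ : ∀ Z → X ⊆ Z → ∂ G Z ⊆ δ′ Z
    ∂Z⊆ Z X⊆Z v∈∂ with v∈Z , ex ← ∂⁻ G v∈∂ = δ⁺ G S v∈Z
      (λ v∈D → proj₂ (∈-─⁻ {p = X} v∈D) (∂⁺ G (proj₁ (∈-─⁻ {p = X} v∈D)) (exits-anti G X⊆Z ex))) (inj₂ ex)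

    bag⊆ : ∀ Z → X ⊆ Z → bag G S X Z ⊆ ∂ G X ∪ δ′ Z
    bag⊆ Z X⊆Z v∈ with bag⁻ G S v∈
    ... | lower v∈∂ = ∪ˡ v∈∂
    ... | upper v∈∂ = ∪ʳ {p = ∂ G X} (∂Z⊆ Z X⊆Z v∈∂)
    ... | root v∈S v∈Z v∉X =
      ∪ʳ {p = ∂ G X} (δ⁺ G S v∈Z (λ v∈D → v∉X (proj₁ (∈-─⁻ {p = X} v∈D))) (inj₁ v∈S))

    -- A smaller `δ′ Z` would make `Z` good by a single growth step, whose bag lies in
    -- `∂ G X ∪ δ′ Z`. Since `∂ G Z` lies in `δ′ Z`, this contradicts `floor`.
    large : ∀ Z → X ⊆ Z → ∣ ⊤ {n F} ∣ ≤ ∣ δ′ Z ∣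
    large Z X⊆Z = ≮⇒≥ λ δZ< → <⇒≱ δZ<
      (≤-trans (floor {Z} (grow good X⊆Z (small-bag (subst (∣ δ′ Z ∣ <_) (∣⊤∣≡n (n F)) δZ<))) X⊆Z) (p⊆q⇒∣p∣≤∣q∣ (∂Z⊆ Z X⊆Z)))
      where
      small-bag : ∣ δ′ Z ∣ < n F → ∣ bag G S X Z ∣ ≤ k
      small-bag δZ< = ≤-trans (p⊆q⇒∣p∣≤∣q∣ (bag⊆ Z X⊆Z)) (≤-trans (∣∪∣≤ (∂ G X) (δ′ Z))
        (+≤1+[2*∸2] (≤-trans small (≤-reflexive (∣⊤∣≡n (n F)))) δZ<))

    δX⊆ : δ′ X ⊆ ∂ G X
    δX⊆ {v} v∈ with v∈X , v∉D , _ ← δ⁻ G S v∈ =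
      decidable-stable (v ∈? ∂ G X) λ v∉∂ → v∉D (x∈p∧x∉q⇒x∈p─q v∈X v∉∂)

    linkage : Linkage G ⊤ S ⊤ X (tip model)
    linkage = menger G ⊤ S ⊤ (λ _ _ _ → ∈⊤) _ D X (tip model) ≤-refl large
      (≤-trans (p⊆q⇒∣p∣≤∣q∣ δX⊆) small) (∂Z⊆ X ⊆-refl ∘ tip∈T model) (λ _ → ∈⊤) (tip-injective model)

theorem3p2 : (F : Graph) → Forest F → n F ≥ 1 →
    (G : Graph) → (S : Subset (n G)) →
    ¬ RootedModel F G S →
    pw≤ G S (2 * n F ∸ 2)
theorem3p2 F forest _ G S ¬model with good? G S (suc (2 * n F ∸ 2)) ⊤
... | yes good = good⇒pw≤ G S good
... | no ¬good = contradiction (root-model F G S ¬good (stage F G S ¬good forest ⊤)) ¬model
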